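{- Let $\mathcal{F}\subseteq\mathcal{V}^*$ be nonempty, let $\mathcal{B}=\{x\in\mathbb{C}^N:\mathbf{B}_{\mathcal{F}}x=x\}$, and define $\mu:=\max_{j\in\mathcal{F},\,i\in\mathcal{V}}|u_j(i)|$. If, for some unknown $\mathcal{S}\subseteq\mathcal{V}$, $$|\mathcal{S}|<\frac{1}{2\mu^2|\mathcal{F}|},$$ then the $\ell_1$-norm reconstruction method $$\tilde{s}=\arg\min_{s'\in\mathcal{B}}\|r-s'\|_1$$ recovers every $s\in\mathcal{B}$ perfectly from $r=s+\mathbf{D}_{\mathcal{S}}n$, for any arbitrary noise $n\in\mathbb{C}^N$ (so that noise is present on at most $|\mathcal{S}|$ vertices); that is, $s$ is the unique minimizer, $\tilde{s}=s$.
   Context: $\mathcal{V}=\{1,\dots,N\}$ is the vertex set of a graph and $\mathcal{V}^*=\{1,\dots,N\}$ is the set of frequency indices. $\mathbf{U}\in\mathbb{C}^{N\times N}$ is a fixed arbitrary unitary matrix with columns $u_1,\dots,u_N$, and $u_j(i)$ is the $i$-th entry of $u_j$. For $\mathcal{S}\subseteq\mathcal{V}$, $\mathbf{D}_{\mathcal{S}}$ is the diagonal matrix whose $i$-th diagonal entry is $1$ if $i\in\mathcal{S}$ and $0$ otherwise. For $\mathcal{F}\subseteq\mathcal{V}^*$, $\mathbf{B}_{\mathcal{F}}=\mathbf{U}\mathbf{\Sigma}_{\mathcal{F}}\mathbf{U}^*$, where $\mathbf{\Sigma}_{\mathcal{F}}$ is the diagonal $0/1$ matrix with $i$-th diagonal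 entry $1$ if and only if $i\in\mathcal{F}$. $\|x\|_1=\sum_i|x(i)|$. "Unknown $\mathcal{S}$" means that the reconstruction method uses only $r$ and $\mathcal{F}$, not $\mathcal{S}$. -}

module Defs where

import Level
open import Level using (Level)
open import Algebra.Bundles using (CommutativeRing; RawRing)
open import Algebra.Apartness.Bundles using (HeytingCommutativeRing)
open import Algebra.Apartness.Structures using (IsHeytingField)
open import Data.Bool.Base using (if_then_else_)
open import Data.Empty using (⊥-elim)
open import Data.Fin.Base using (Fin; zero; suc)
open import Data.Fin.Properties using (_≟_)
open import Data.Fin.Subset using (Subset; Nonempty; ∣_∣)
open import Data.Fin.Subset.Properties using (x∈p⇒∣p-x∣<∣p∣)
open import Data.Nat.Base as ℕ using (ℕ; zero; suc)
open import Data.Product.Base using (∃; _×_; _,_; proj₁; proj₂)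
open import Data.Sum.Base using (_⊎_; inj₁; inj₂)
open import Data.Vec.Base using (lookup)
open import Data.Vec.Functional using (Vector; foldr)
open import Data.Vec.Properties using ([]=⇒lookup)
open import Function.Base using (_∘_)
open import Relation.Binary.Core using (Rel)
open import Relation.Binary.Lattice.Definitions using (Supremum)
open import Relation.Binary.PropositionalEquality as ≡ using (_≡_)
open import Relation.Binary.Structures using (IsStrictPartialOrder)
open import Relation.Nullary using (¬_; does)
open import Relation.Nullary.Decidable using (dec-true)
import Data.Nat.Properties as ℕₚ
import Algebra.Definitions.RawMonoid as RawMonoidDefs
import Algebra.Apartness.Properties.HeytingCommutativeRing as HeytingProperties
import Algebra.Properties.Ring as RingProperties

-- The real numbers, as the Cauchy-complete Archimedean ordered field, which is
-- unique up to isomorphism.  The axioms are the constructively valid ones, so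
-- the order is not assumed to be decidable: _≤_ is the negation of the
-- converse of _<_, and x # y means x < y or y < x.  Binary maxima and square
-- roots exist by completeness; they are included as operations, each
-- determined by its specification (√ only on nonnegative arguments).
record RealNumbers (c ℓ₁ ℓ₂ : Level) : Set (Level.suc (c Level.⊔ ℓ₁ Level.⊔ ℓ₂)) where
  infix  4 _≈_ _<_ _≤_ _#_
  infixl 6 _+_ _⊔_
  infixl 7 _*_
  infix  8 -_
  field
    Carrier : Set c
    _≈_     : Rel Carrier ℓ₁
    _<_     : Rel Carrier ℓ₂
    _+_ _*_ : Carrier → Carrier → Carrier
    -_      : Carrier → Carrier
    0# 1#   : Carrier

  _≤_ : Rel Carrier ℓ₂
  x ≤ y = ¬ (y < x)

  _#_ : Rel Carrier ℓ₂
  x # y = x < y ⊎ y < x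

  field
    isHeytingField       : IsHeytingField _≈_ _#_ _+_ _*_ -_ 0# 1#
    isStrictPartialOrder : IsStrictPartialOrder _≈_ _<_
    +-monoˡ-<            : ∀ {x y} z → x < y → x + z < y + z
    *-pos                : ∀ {x y} → 0# < x → 0# < y → 0# < x * y

  heytingCommutativeRing : HeytingCommutativeRing c ℓ₁ ℓ₂
  heytingCommutativeRing = record
    { isHeytingCommutativeRing = IsHeytingField.isHeytingCommutativeRing isHeytingField }

  commutativeRing : CommutativeRing c ℓ₁
  commutativeRing = HeytingCommutativeRing.commutativeRing heytingCommutativeRing

  open CommutativeRing commutativeRing public
    using (_-_; +-rawMonoid)

  open RawMonoidDefs +-rawMonoid public
    using (sum)
    renaming (_×_ to _×ᴿ_)

  fromℕ : ℕ → Carrier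
  fromℕ n = n ×ᴿ 1#

  Cauchy : (ℕ → Carrier) → Set _
  Cauchy f = ∀ ε → 0# < ε → ∃ λ K → ∀ m n → K ℕ.≤ m → K ℕ.≤ n → f m - f n < ε

  ConvergesTo : (ℕ → Carrier) → Carrier → Set _
  ConvergesTo f x = ∀ ε → 0# < ε → ∃ λ K → ∀ n → K ℕ.≤ n → (f n - x < ε) × (x - f n < ε)

  field
    archimedean : ∀ x → ∃ λ n → x < fromℕ n
    complete    : ∀ f → Cauchy f → ∃ (ConvergesTo f)
    _⊔_         : Carrier → Carrier → Carrier
    ⊔-supremum  : Supremum _≤_ _⊔_
    √           : Carrier → Carrier
    √-nonneg    : ∀ {x} → 0# ≤ x → 0# ≤ √ x
    √-square    : ∀ {x} → 0# ≤ x → √ x * √ x ≈ x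

  recip : ∀ x → 0# < x → Carrier
  recip x 0<x = proj₁ (IsHeytingField.#⇒invertible isHeytingField {x} {0#} (inj₂ 0<x))

  -- The greatest entry of a nonempty family of nonnegative reals (the value on
  -- the empty family is 0).
  maximum : ∀ {n} → Vector Carrier n → Carrier
  maximum = foldr _⊔_ 0#


module RealProperties {c ℓ₁ ℓ₂} (R : RealNumbers c ℓ₁ ℓ₂) where
  open RealNumbers R
  open CommutativeRing commutativeRing
    using (setoid; ring; refl; sym; trans; +-congˡ; +-congʳ; +-identityˡ; +-identityʳ;
           +-assoc; +-comm; -‿inverseʳ; *-congˡ; *-assoc; *-identityˡ)
  open IsStrictPartialOrder isStrictPartialOrder public
    using (<-respʳ-≈; <-respˡ-≈)
    renaming (irrefl to <-irrefl; trans to <-trans; asym to <-asym)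
  open HeytingCommutativeRing heytingCommutativeRing
    using (#-cotrans; #⇒invertible)
  open HeytingProperties heytingCommutativeRing
    using (invertibleˡ⇒#; 1#0; x-0≈x)
  open RingProperties ring
    using (-‿distribˡ-*; -‿distribʳ-*; -‿involutive)

  <-cotrans : ∀ {x y} → x < y → ∀ z → x < z ⊎ z < y
  <-cotrans x<y z with #-cotrans (inj₁ x<y) z
  ... | inj₁ (inj₁ x<z) = inj₁ x<z
  ... | inj₁ (inj₂ z<x) = inj₂ (<-trans z<x x<y)
  ... | inj₂ (inj₁ z<y) = inj₂ z<y
  ... | inj₂ (inj₂ y<z) = inj₁ (<-trans x<y y<z)

  <-≤-trans : ∀ {x y z} → x < y → y ≤ z → x < z
  <-≤-trans {z = z} x<y y≤z with <-cotrans x<y z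
  ... | inj₁ x<z = x<z
  ... | inj₂ z<y = ⊥-elim (y≤z z<y)

  ≤-trans : ∀ {x y z} → x ≤ y → y ≤ z → x ≤ z
  ≤-trans x≤y y≤z z<x = x≤y (≤-<-trans′ y≤z z<x)
    where
    ≤-<-trans′ : ∀ {x y z} → x ≤ y → y < z → x < z
    ≤-<-trans′ {x} x≤y y<z with <-cotrans y<z x
    ... | inj₁ y<x = ⊥-elim (x≤y y<x)
    ... | inj₂ x<z = x<z

  +-cancelˡ-< : ∀ x {y z} → x + y < x + z → y < z
  +-cancelˡ-< x {y} {z} p =
    <-respˡ-≈ (cancel y) (<-respʳ-≈ (cancel z) (+-monoˡ-< (- x) p))
    where
    cancel : ∀ w → x + w + - x ≈ w
    cancel w = trans (+-congʳ (+-comm x w))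
      (trans (+-assoc w x (- x)) (trans (+-congˡ (-‿inverseʳ x)) (+-identityʳ w)))

  x<0⇒0<-x : ∀ {x} → x < 0# → 0# < - x
  x<0⇒0<-x {x} x<0 =
    <-respˡ-≈ (-‿inverseʳ x) (<-respʳ-≈ (+-identityˡ (- x)) (+-monoˡ-< (- x) x<0))

  x#0⇒0<x² : ∀ {x} → x # 0# → 0# < x * x
  x#0⇒0<x² (inj₂ 0<x) = *-pos 0<x 0<x
  x#0⇒0<x² {x} (inj₁ x<0) =
    <-respʳ-≈ -x*-x≈x*x (*-pos (x<0⇒0<-x x<0) (x<0⇒0<-x x<0))
    where
    -x*-x≈x*x : - x * - x ≈ x * x
    -x*-x≈x*x = trans (sym (-‿distribˡ-* x (- x)))
      (trans (CommutativeRing.-‿cong commutativeRing (sym (-‿distribʳ-* x x)))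
        (-‿involutive (x * x)))

  x²#0⇒x#0 : ∀ {x} → x * x # 0# → x # 0#
  x²#0⇒x#0 {x} x²#0 with #⇒invertible x²#0
  ... | y , y[x²-0]≈1 , _ = invertibleˡ⇒# (y * x ,
    trans (*-congˡ (x-0≈x x)) (trans (*-assoc y x x)
      (trans (*-congˡ (sym (x-0≈x (x * x)))) y[x²-0]≈1)))

  0≤x² : ∀ x → 0# ≤ x * x
  0≤x² x x²<0 = <-asym x²<0 (x#0⇒0<x² (x²#0⇒x#0 (inj₁ x²<0)))

  0<1 : 0# < 1#
  0<1 = <-respʳ-≈ (*-identityˡ 1#) (x#0⇒0<x² 1#0)

  0≤x∧0<x²⇒0<x : ∀ {x} → 0# ≤ x → 0# < x * x → 0# < x
  0≤x∧0<x²⇒0<x 0≤x 0<x² with x²#0⇒x#0 (inj₂ 0<x²)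
  ... | inj₁ x<0 = ⊥-elim (0≤x x<0)
  ... | inj₂ 0<x = 0<x

  0<x+y⇒0<x⊎0<y : ∀ {x y} → 0# < x + y → 0# < x ⊎ 0# < y
  0<x+y⇒0<x⊎0<y {x} {y} p with <-cotrans p x
  ... | inj₁ 0<x = inj₁ 0<x
  ... | inj₂ x<x+y = inj₂ (+-cancelˡ-< x (<-respˡ-≈ (sym (+-identityʳ x)) x<x+y))

  0≤x∧0≤y⇒0≤x+y : ∀ {x y} → 0# ≤ x → 0# ≤ y → 0# ≤ x + y
  0≤x∧0≤y⇒0≤x+y {x} {y} 0≤x 0≤y p with <-cotrans p x
  ... | inj₁ x+y<x = 0≤y (+-cancelˡ-< x (<-respʳ-≈ (sym (+-identityʳ x)) x+y<x))
  ... | inj₂ x<0 = 0≤x x<0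

  0<x∧0≤y⇒0<x+y : ∀ {x y} → 0# < x → 0# ≤ y → 0# < x + y
  0<x∧0≤y⇒0<x+y {x} {y} 0<x 0≤y with <-cotrans 0<x (x + y)
  ... | inj₁ 0<x+y = 0<x+y
  ... | inj₂ x+y<x = ⊥-elim (0≤y (+-cancelˡ-< x (<-respʳ-≈ (sym (+-identityʳ x)) x+y<x)))

  0≤fromℕ : ∀ n → 0# ≤ fromℕ n
  0≤fromℕ zero    = <-irrefl refl
  0≤fromℕ (suc n) = 0≤x∧0≤y⇒0≤x+y (<-asym 0<1) (0≤fromℕ n)

  0<fromℕ : ∀ {n} → 0 ℕ.< n → 0# < fromℕ n
  0<fromℕ {suc n} _ = 0<x∧0≤y⇒0<x+y 0<1 (0≤fromℕ n)

  0<sum⇒∃0< : ∀ {n} (v : Vector Carrier n) → 0# < sum v → ∃ λ i → 0# < v i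
  0<sum⇒∃0< {zero}  v p = ⊥-elim (<-irrefl refl p)
  0<sum⇒∃0< {suc n} v p with 0<x+y⇒0<x⊎0<y p
  ... | inj₁ 0<v₀ = zero , 0<v₀
  ... | inj₂ q with 0<sum⇒∃0< (v ∘ suc) q
  ... | i , 0<vᵢ = suc i , 0<vᵢ

  maximum-upperBound : ∀ {n} (v : Vector Carrier n) i → v i ≤ maximum v
  maximum-upperBound v zero    = proj₁ (⊔-supremum (v zero) (maximum (v ∘ suc)))
  maximum-upperBound v (suc i) = ≤-trans (maximum-upperBound (v ∘ suc) i)
    (proj₁ (proj₂ (⊔-supremum (v zero) (maximum (v ∘ suc)))))

  maximum-least : ∀ {n} (v : Vector Carrier n) {b} → 0# ≤ b → (∀ i → v i ≤ b) → maximum v ≤ b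
  maximum-least {zero}  v 0≤b v≤b = 0≤b
  maximum-least {suc n} v 0≤b v≤b =
    proj₂ (proj₂ (⊔-supremum (v zero) (maximum (v ∘ suc)))) _ (v≤b zero)
      (maximum-least (v ∘ suc) 0≤b (v≤b ∘ suc))


module ComplexNumbers {c ℓ₁ ℓ₂} (R : RealNumbers c ℓ₁ ℓ₂) where
  open RealNumbers R

  infix  4 _≈ᶜ_
  infixl 6 _+ᶜ_ _-ᶜ_
  infixl 7 _*ᶜ_
  infix  8 -ᶜ_

  record ℂ : Set c where
    constructor _+i_
    field
      re im : Carrier
  open ℂ public

  _≈ᶜ_ : Rel ℂ ℓ₁
  z ≈ᶜ w = re z ≈ re w × im z ≈ im w

  _+ᶜ_ _*ᶜ_ : ℂ → ℂ → ℂ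
  z +ᶜ w = (re z + re w) +i (im z + im w)
  z *ᶜ w = (re z * re w - im z * im w) +i (re z * im w + im z * re w)

  -ᶜ_ conj : ℂ → ℂ
  -ᶜ z   = (- re z) +i (- im z)
  conj z = re z +i (- im z)

  _-ᶜ_ : ℂ → ℂ → ℂ
  z -ᶜ w = z +ᶜ (-ᶜ w)

  0ᶜ 1ᶜ : ℂ
  0ᶜ = 0# +i 0#
  1ᶜ = 1# +i 0#

  ℂ-rawRing : RawRing c ℓ₁
  ℂ-rawRing = record
    { _≈_ = _≈ᶜ_ ; _+_ = _+ᶜ_ ; _*_ = _*ᶜ_ ; -_ = -ᶜ_ ; 0# = 0ᶜ ; 1# = 1ᶜ }

  open RawMonoidDefs (RawRing.+-rawMonoid ℂ-rawRing) public
    using () renaming (sum to sumᶜ)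

  modulus : ℂ → Carrier
  modulus z = √ (re z * re z + im z * im z)


module LinearAlgebra {c ℓ₁ ℓ₂} (R : RealNumbers c ℓ₁ ℓ₂) where
  open RealNumbers R
  open ComplexNumbers R public

  infix  4 _≈ᵥ_ _≈ₘ_
  infixl 6 _+ᵥ_ _-ᵥ_
  infixr 7 _*ᵥ_
  infixl 7 _*ₘ_
  infix  8 _†

  Matrix : ℕ → Set c
  Matrix N = Fin N → Fin N → ℂ

  _≈ᵥ_ : ∀ {N} → Rel (Vector ℂ N) ℓ₁
  x ≈ᵥ y = ∀ i → x i ≈ᶜ y i

  _≈ₘ_ : ∀ {N} → Rel (Matrix N) ℓ₁
  A ≈ₘ B = ∀ i j → A i j ≈ᶜ B i j

  _+ᵥ_ _-ᵥ_ : ∀ {N} → Vector ℂ N → Vector ℂ N → Vector ℂ N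
  (x +ᵥ y) i = x i +ᶜ y i
  (x -ᵥ y) i = x i -ᶜ y i

  _*ₘ_ : ∀ {N} → Matrix N → Matrix N → Matrix N
  (A *ₘ B) i k = sumᶜ λ j → A i j *ᶜ B j k

  _*ᵥ_ : ∀ {N} → Matrix N → Vector ℂ N → Vector ℂ N
  (A *ᵥ x) i = sumᶜ λ j → A i j *ᶜ x j

  _† : ∀ {N} → Matrix N → Matrix N
  (A †) i j = conj (A j i)

  diagonal : ∀ {N} → Vector ℂ N → Matrix N
  diagonal d i j = if does (i ≟ j) then d i else 0ᶜ

  identity : ∀ {N} → Matrix N
  identity = diagonal λ _ → 1ᶜ

  IsUnitary : ∀ {N} → Matrix N → Set ℓ₁
  IsUnitary U = (U † *ₘ U ≈ₘ identity) × (U *ₘ U † ≈ₘ identity)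

  ∥_∥₁ : ∀ {N} → Vector ℂ N → Carrier
  ∥ x ∥₁ = sum λ i → modulus (x i)


module Bandlimiting {c ℓ₁ ℓ₂} (R : RealNumbers c ℓ₁ ℓ₂) where
  open RealNumbers R
  open RealProperties R
  open LinearAlgebra R public

  -- This is D_S on the vertex side and Σ_F on the frequency side.
  projection : ∀ {N} → Subset N → Matrix N
  projection S = diagonal λ i → if lookup S i then 1ᶜ else 0ᶜ

  bandlimiter : ∀ {N} → Matrix N → Subset N → Matrix N
  bandlimiter U F = U *ₘ projection F *ₘ U †

  Bandlimited : ∀ {N} → Matrix N → Subset N → Vector ℂ N → Set ℓ₁
  Bandlimited U F x = bandlimiter U F *ᵥ x ≈ᵥ x

  -- The frequency vector u_j is the j-th column of U, so u_j(i) is U i j.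
  -- Frequencies outside F contribute 0, which is harmless as moduli are
  -- nonnegative.
  μ : ∀ {N} → Matrix N → Subset N → Carrier
  μ U F = maximum λ j → if lookup F j then (maximum λ i → modulus (U i j)) else 0#

  -- s̃ ∈ argmin { ∥ r - s′ ∥₁ : s′ bandlimited }
  IsReconstruction : ∀ {N} → Matrix N → Subset N → Vector ℂ N → Vector ℂ N → Set _
  IsReconstruction U F r s̃ =
    Bandlimited U F s̃ × (∀ s′ → Bandlimited U F s′ → ∥ r -ᵥ s̃ ∥₁ ≤ ∥ r -ᵥ s′ ∥₁)

  2μ²∣F∣ : ∀ {N} → Matrix N → Subset N → Carrier
  2μ²∣F∣ U F = fromℕ 2 * (μ U F * μ U F) * fromℕ ∣ F ∣

  private
    re-sum : ∀ {n} (v : Vector ℂ n) → re (sumᶜ v) ≡ sum (re ∘ v)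
    re-sum {zero}  v = ≡.refl
    re-sum {suc n} v = ≡.cong (re (v zero) +_) (re-sum (v ∘ suc))

    0<re[z̄z]⇒0<∣z∣ : ∀ z → 0# < re (conj z *ᶜ z) → 0# < modulus z
    0<re[z̄z]⇒0<∣z∣ z p = 0≤x∧0<x²⇒0<x (√-nonneg 0≤n)
      (<-respʳ-≈ (sym (√-square 0≤n)) (<-respʳ-≈ eq p))
      where
      open CommutativeRing commutativeRing using (ring; sym; trans; +-congˡ; -‿cong)
      open RingProperties ring using (-‿distribˡ-*; -‿involutive)
      0≤n : 0# ≤ re z * re z + im z * im z
      0≤n = 0≤x∧0≤y⇒0≤x+y (0≤x² (re z)) (0≤x² (im z))
      eq : re (conj z *ᶜ z) ≈ re z * re z + im z * im z
      eq = +-congˡ (trans (-‿cong (sym (-‿distribˡ-* (im z) (im z)))) (-‿involutive _))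

  0<μ : ∀ {N} (U : Matrix N) (F : Subset N) → IsUnitary U → Nonempty F → 0# < μ U F
  0<μ {N} U F (U†U≈I , _) (j , j∈F) = <-≤-trans 0<∣Uij∣ ∣Uij∣≤μ
    where
    open CommutativeRing commutativeRing using (sym; trans; reflexive)
    column : Vector Carrier N
    column i = re (conj (U i j) *ᶜ U i j)

    sum-column≈1 : sum column ≈ 1#
    sum-column≈1 = trans (reflexive (≡.sym (re-sum λ i → conj (U i j) *ᶜ U i j)))
      (trans (proj₁ (U†U≈I j j))
        (reflexive (≡.cong (λ b → re (if b then 1ᶜ else 0ᶜ)) (dec-true (j ≟ j) ≡.refl))))

    nonzero : ∃ λ i → 0# < column i
    nonzero = 0<sum⇒∃0< column (<-respʳ-≈ (sym sum-column≈1) 0<1)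

    i : Fin N
    i = proj₁ nonzero

    0<∣Uij∣ : 0# < modulus (U i j)
    0<∣Uij∣ = 0<re[z̄z]⇒0<∣z∣ (U i j) (proj₂ nonzero)

    column-max : Vector Carrier N
    column-max j = if lookup F j then (maximum λ i → modulus (U i j)) else 0#

    ∣Uij∣≤μ : modulus (U i j) ≤ μ U F
    ∣Uij∣≤μ = ≤-trans (maximum-upperBound (λ i → modulus (U i j)) i)
      (≡.subst (_≤ μ U F)
        (≡.cong (λ b → if b then (maximum λ i → modulus (U i j)) else 0#) ([]=⇒lookup j∈F))
        (maximum-upperBound column-max j))

  0<2μ²∣F∣ : ∀ {N} (U : Matrix N) (F : Subset N) → IsUnitary U → Nonempty F → 0# < 2μ²∣F∣ U F
  0<2μ²∣F∣ U F unitary F≠∅@(j , j∈F) =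
    *-pos (*-pos (0<fromℕ {2} (ℕ.s≤s ℕ.z≤n)) (*-pos 0<μ′ 0<μ′)) (0<fromℕ 0<∣F∣)
    where
    0<μ′ : 0# < μ U F
    0<μ′ = 0<μ U F unitary F≠∅
    0<∣F∣ : 0 ℕ.< ∣ F ∣
    0<∣F∣ = ℕₚ.≤-<-trans ℕ.z≤n (x∈p⇒∣p-x∣<∣p∣ j∈F)

{-# OPTIONS --safe #-}
-- Let x = s̃ - s for a competitor s̃.  Since B_F x = x and the entries of B_F
-- have modulus at most |F|μ², every |x i| is at most |F|μ²∥x∥₁, so at most the
-- fraction κ / 2 of ∥x∥₁ lies on S, where κ = 2μ²|F||S| < 1.  Off S the
-- residual r - s vanishes, so the triangle inequality at each vertex gives
-- ∥r - s∥₁ + ∥x∥₁ ≤ ∥r - s̃∥₁ + κ∥x∥₁, that is, s̃ is worse than s by at least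
-- (1 - κ)∥x∥₁.
module Submission where

open import Defs
open import Algebra.Bundles using (CommutativeRing)
open import Algebra.Apartness.Structures using (IsHeytingField)
open import Data.Bool.Base using (true; false; if_then_else_)
open import Data.Empty using (⊥-elim)
open import Data.Fin.Base using (Fin; zero; suc)
open import Data.Fin.Properties using (_≟_; suc-injective)
open import Data.Fin.Subset using (Subset; Nonempty; ∣_∣)
open import Data.Nat.Base using (ℕ; zero; suc)
open import Data.Product.Base using (_×_; _,_; proj₁; proj₂)
open import Data.Sum.Base using (inj₁; inj₂)
open import Data.Vec.Base using ([]; _∷_; lookup)
open import Data.Vec.Functional using (Vector)
open import Function.Base using (_∘_)
open import Relation.Binary.PropositionalEquality as ≡ using (_≡_; _≢_)
open import Relation.Binary.Structures using (IsPreorder)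
open import Relation.Nullary using (¬_; yes; no)
import Algebra.Apartness.Properties.HeytingCommutativeRing as HeytingProperties
import Algebra.Properties.AbelianGroup as AbelianGroupProperties
import Algebra.Properties.CommutativeSemigroup as CommutativeSemigroupProperties
import Algebra.Properties.Ring as RingProperties
import Algebra.Properties.Semiring.Sum as SemiringSum
import Algebra.Solver.Ring.NaturalCoefficients.Default as SemiringSolver
import Relation.Binary.Reasoning.Base.Triple as TripleReasoning

-- Order arithmetic in a field whose order need not be decidable.

module OrderedField {c ℓ₁ ℓ₂} (R : RealNumbers c ℓ₁ ℓ₂) where
  open RealNumbers R
  open RealProperties R public
  open CommutativeRing commutativeRing public
    using (isEquivalence; refl; sym; trans; +-cong; +-congˡ; +-congʳ;
           +-comm; +-assoc; +-identityˡ; +-identityʳ; -‿inverseʳ; -‿cong;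
           *-cong; *-congˡ; *-congʳ; *-comm; *-identityˡ; *-identityʳ;
           distribʳ; zeroˡ; zeroʳ)
  open CommutativeRing commutativeRing
    using (ring; semiring; commutativeSemiring; +-abelianGroup; +-commutativeSemigroup)
  open RingProperties ring public
    using (-‿distribˡ-*; -‿distribʳ-*; -‿involutive; -0#≈0#; x[y-z]≈xy-xz)
  open AbelianGroupProperties +-abelianGroup public
    using ()
    renaming (⁻¹-∙-comm to -‿+-comm; ⁻¹-anti-homo‿- to -[x-y]≈y-x; xyx⁻¹≈y to x+y-x≈y;
              x∙y⁻¹≈ε⇒x≈y to x-y≈0⇒x≈y; //-rightDividesˡ to y-x+x≈y)
  open CommutativeSemigroupProperties +-commutativeSemigroup public
    using () renaming (interchange to +-interchange)
  open SemiringSum semiring public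
    using (∑-distrib-+; *-distribˡ-sum)
  module Solver = SemiringSolver commutativeSemiring

  -- Tightness of apartness is the way to reach an equality here: exclude both strict orders,
  -- without ever deciding between them.
  ¬x#y⇒x≈y : ∀ {x y} → ¬ (x # y) → x ≈ y
  ¬x#y⇒x≈y = proj₁ (IsHeytingField.tight isHeytingField _ _)

  -- Cotransitivity stands in for trichotomy: placing `x` against `y < z` gives either `y < x`,
  -- which `x ≤ y` refutes, or the goal.
  ≤-<-trans : ∀ {x y z} → x ≤ y → y < z → x < z
  ≤-<-trans {x} x≤y y<z with <-cotrans y<z x
  ... | inj₁ y<x = ⊥-elim (x≤y y<x)
  ... | inj₂ x<z = x<z

  <⇒≤ : ∀ {x y} → x < y → x ≤ y
  <⇒≤ = <-asym

  ≤-reflexive : ∀ {x y} → x ≈ y → x ≤ y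
  ≤-reflexive x≈y = <-irrefl (sym x≈y)

  ≤-refl : ∀ {x} → x ≤ x
  ≤-refl = ≤-reflexive refl

  ≤-isPreorder : IsPreorder _≈_ _≤_
  ≤-isPreorder = record
    { isEquivalence = isEquivalence ; reflexive = ≤-reflexive ; trans = ≤-trans }

  module ≤-Reasoning = TripleReasoning {_≈_ = _≈_} {_≤_ = _≤_} {_<_ = _<_}
    ≤-isPreorder
    <-asym <-trans (<-respʳ-≈ , <-respˡ-≈) <⇒≤ <-≤-trans ≤-<-trans

  +-cancelʳ-< : ∀ {x y} z → x + z < y + z → x < y
  +-cancelʳ-< {x} {y} z p =
    +-cancelˡ-< z (<-respˡ-≈ (+-comm x z) (<-respʳ-≈ (+-comm y z) p))

  +-cancelʳ-≤ : ∀ {x y} z → x + z ≤ y + z → x ≤ y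
  +-cancelʳ-≤ z p y<x = p (+-monoˡ-< z y<x)

  +-monoˡ-≤ : ∀ {x y} z → x ≤ y → x + z ≤ y + z
  +-monoˡ-≤ z x≤y = x≤y ∘ +-cancelʳ-< z

  +-monoʳ-≤ : ∀ {x y} z → x ≤ y → z + x ≤ z + y
  +-monoʳ-≤ z x≤y = x≤y ∘ +-cancelˡ-< z

  +-mono-≤ : ∀ {x y u v} → x ≤ y → u ≤ v → x + u ≤ y + v
  +-mono-≤ {y = y} {u} x≤y u≤v = ≤-trans (+-monoˡ-≤ u x≤y) (+-monoʳ-≤ y u≤v)

  +-monoʳ-< : ∀ {x y} z → x < y → z + x < z + y
  +-monoʳ-< {x} {y} z x<y =
    <-respˡ-≈ (+-comm x z) (<-respʳ-≈ (+-comm y z) (+-monoˡ-< z x<y))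

  0≤y⇒x≤x+y : ∀ {x y} → 0# ≤ y → x ≤ x + y
  0≤y⇒x≤x+y {x} 0≤y = ≤-trans (≤-reflexive (sym (+-identityʳ x))) (+-monoʳ-≤ x 0≤y)

  x≤y⇒0≤y-x : ∀ {x y} → x ≤ y → 0# ≤ y - x
  x≤y⇒0≤y-x {x} {y} x≤y =
    +-cancelʳ-≤ x (≤-trans (≤-reflexive (+-identityˡ x))
      (≤-trans x≤y (≤-reflexive (sym (y-x+x≈y x y)))))

  x<y⇒0<y-x : ∀ {x y} → x < y → 0# < y - x
  x<y⇒0<y-x {x} {y} x<y =
    +-cancelʳ-< x (<-respˡ-≈ (sym (+-identityˡ x)) (<-respʳ-≈ (sym (y-x+x≈y x y)) x<y))

  -- The signs of `x` and `y` cannot be decided, so suppose `x * y < 0#`. If `0# < x`, then `y` can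
  -- be neither negative nor positive, hence is zero, and the product is zero after all. So `x` is
  -- not positive; being nonnegative it is zero, and again the product vanishes.
  *-nonneg : ∀ {x y} → 0# ≤ x → 0# ≤ y → 0# ≤ x * y
  *-nonneg {x} {y} 0≤x 0≤y xy<0 = <-irrefl xy≈0 xy<0
    where
    y≈0 : 0# < x → y ≈ 0#
    y≈0 0<x = ¬x#y⇒x≈y λ where
      (inj₁ y<0) → 0≤y y<0
      (inj₂ 0<y) → <-asym xy<0 (*-pos 0<x 0<y)
    x≈0 : x ≈ 0#
    x≈0 = ¬x#y⇒x≈y λ where
      (inj₁ x<0) → 0≤x x<0
      (inj₂ 0<x) → <-irrefl (trans (*-congˡ (y≈0 0<x)) (zeroʳ x)) xy<0
    xy≈0 : x * y ≈ 0#
    xy≈0 = trans (*-congʳ x≈0) (zeroˡ y)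

  [y-x]z+xz≈yz : ∀ x y z → (y - x) * z + x * z ≈ y * z
  [y-x]z+xz≈yz x y z = trans (sym (distribʳ z (y - x) x)) (*-congʳ (y-x+x≈y x y))

  *-monoˡ-≤ : ∀ {x y z} → 0# ≤ z → x ≤ y → x * z ≤ y * z
  *-monoˡ-≤ {x} {y} {z} 0≤z x≤y = begin
    x * z                ≈⟨ +-identityˡ (x * z) ⟨
    0# + x * z           ≤⟨ +-monoˡ-≤ (x * z) (*-nonneg (x≤y⇒0≤y-x x≤y) 0≤z) ⟩
    (y - x) * z + x * z  ≈⟨ [y-x]z+xz≈yz x y z ⟩
    y * z                ∎
    where open ≤-Reasoning

  *-monoˡ-< : ∀ {x y z} → 0# < z → x < y → x * z < y * z
  *-monoˡ-< {x} {y} {z} 0<z x<y = begin-strict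
    x * z                ≈⟨ +-identityˡ (x * z) ⟨
    0# + x * z           <⟨ +-monoˡ-< (x * z) (*-pos (x<y⇒0<y-x x<y) 0<z) ⟩
    (y - x) * z + x * z  ≈⟨ [y-x]z+xz≈yz x y z ⟩
    y * z                ∎
    where open ≤-Reasoning

  *-mono-≤ : ∀ {x y u v} → 0# ≤ y → 0# ≤ u → x ≤ y → u ≤ v → x * u ≤ y * v
  *-mono-≤ {x} {y} {u} {v} 0≤y 0≤u x≤y u≤v = begin
    x * u  ≤⟨ *-monoˡ-≤ 0≤u x≤y ⟩
    y * u  ≈⟨ *-comm y u ⟩
    u * y  ≤⟨ *-monoˡ-≤ 0≤y u≤v ⟩
    v * y  ≈⟨ *-comm v y ⟩
    y * v  ∎
    where open ≤-Reasoning

  -- Were `y < x`, then `y * y ≤ x * y < x * x`, as `x` would be positive. Upper bounds on moduli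
  -- are obtained through this comparison of squares.
  x²≤y²⇒x≤y : ∀ {x y} → 0# ≤ y → x * x ≤ y * y → x ≤ y
  x²≤y²⇒x≤y {x} {y} 0≤y x²≤y² y<x = x²≤y² (begin-strict
    y * y  ≤⟨ *-monoˡ-≤ 0≤y (<⇒≤ y<x) ⟩
    x * y  ≈⟨ *-comm x y ⟩
    y * x  <⟨ *-monoˡ-< (≤-<-trans 0≤y y<x) y<x ⟩
    x * x  ∎)
    where open ≤-Reasoning

  -x*-x≈x*x : ∀ x → - x * - x ≈ x * x
  -x*-x≈x*x x = trans (sym (-‿distribˡ-* x (- x)))
    (trans (-‿cong (sym (-‿distribʳ-* x x))) (-‿involutive (x * x)))

  x-z≈[x-y]+[y-z] : ∀ x y z → x - z ≈ (x - y) + (y - z)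
  x-z≈[x-y]+[y-z] x y z = trans (+-congʳ (sym (y-x+x≈y y x))) (+-assoc (x - y) y (- z))

  [w+x]-[y+z]≈[w-y]+[x-z] : ∀ w x y z → (w + x) - (y + z) ≈ (w - y) + (x - z)
  [w+x]-[y+z]≈[w-y]+[x-z] w x y z =
    trans (+-congˡ (sym (-‿+-comm y z))) (+-interchange w x (- y) (- z))

  -- Finite sums of reals.

  sum-mono-≤ : ∀ {n} {v w : Vector Carrier n} → (∀ i → v i ≤ w i) → sum v ≤ sum w
  sum-mono-≤ {zero}  v≤w = ≤-refl
  sum-mono-≤ {suc n} v≤w = +-mono-≤ (v≤w zero) (sum-mono-≤ (v≤w ∘ suc))

  sum-nonneg : ∀ {n} {v : Vector Carrier n} → (∀ i → 0# ≤ v i) → 0# ≤ sum v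
  sum-nonneg {zero}  0≤v = ≤-refl
  sum-nonneg {suc n} 0≤v = 0≤x∧0≤y⇒0≤x+y (0≤v zero) (sum-nonneg (0≤v ∘ suc))

  sum-nonpos : ∀ {n} {v : Vector Carrier n} → (∀ i → v i ≤ 0#) → sum v ≤ 0#
  sum-nonpos {zero}  v≤0 = ≤-refl
  sum-nonpos {suc n} v≤0 =
    ≤-trans (+-mono-≤ (v≤0 zero) (sum-nonpos (v≤0 ∘ suc))) (≤-reflexive (+-identityˡ 0#))

  entry≤sum : ∀ {n} {v : Vector Carrier n} → (∀ i → 0# ≤ v i) → ∀ i → v i ≤ sum v
  entry≤sum 0≤v zero = 0≤y⇒x≤x+y (sum-nonneg (0≤v ∘ suc))
  entry≤sum {v = v} 0≤v (suc i) = ≤-trans (entry≤sum (0≤v ∘ suc) i)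
    (≤-trans (0≤y⇒x≤x+y (0≤v zero)) (≤-reflexive (+-comm _ (v zero))))

  -- An upper bound is enough to collapse a sum against a column of a 0/1 diagonal matrix to its one
  -- surviving term.
  sum≤entry : ∀ {n} {v : Vector Carrier n} i → (∀ j → j ≢ i → v j ≤ 0#) → sum v ≤ v i
  sum≤entry {v = v} zero v≤0 = ≤-trans
    (+-monoʳ-≤ (v zero) (sum-nonpos λ j → v≤0 (suc j) λ ()))
    (≤-reflexive (+-identityʳ (v zero)))
  sum≤entry {v = v} (suc i) v≤0 = ≤-trans
    (+-mono-≤ (v≤0 zero λ ()) (sum≤entry i λ j j≢i → v≤0 (suc j) (j≢i ∘ suc-injective)))
    (≤-reflexive (+-identityˡ (v (suc i))))

  -- This is where the cardinalities of `F` and `S` enter the estimates.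
  sum-indicator : ∀ {n} (S : Subset n) x →
    sum (λ i → if lookup S i then x else 0#) ≈ fromℕ ∣ S ∣ * x
  sum-indicator []          x = sym (zeroˡ x)
  sum-indicator (true  ∷ S) x = trans (+-cong (sym (*-identityˡ x)) (sum-indicator S x))
    (sym (distribʳ x 1# (fromℕ ∣ S ∣)))
  sum-indicator (false ∷ S) x = trans (+-identityˡ _) (sum-indicator S x)

-- The modulus of a complex number: multiplicativity, triangle inequality, definiteness.

module Modulus {c ℓ₁ ℓ₂} (R : RealNumbers c ℓ₁ ℓ₂) where
  open RealNumbers R
  open ComplexNumbers R
  open OrderedField R
  open Solver using (solve; _:+_; _:*_; _:=_)
  open ≤-Reasoning

  normSquare : ℂ → Carrier
  normSquare z = re z * re z + im z * im z

  0≤normSquare : ∀ z → 0# ≤ normSquare z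
  0≤normSquare z = 0≤x∧0≤y⇒0≤x+y (0≤x² (re z)) (0≤x² (im z))

  0≤modulus : ∀ z → 0# ≤ modulus z
  0≤modulus z = √-nonneg (0≤normSquare z)

  modulus² : ∀ z → modulus z * modulus z ≈ normSquare z
  modulus² z = √-square (0≤normSquare z)

  normSquare≤y²⇒modulus≤y : ∀ {z y} → 0# ≤ y → normSquare z ≤ y * y → modulus z ≤ y
  normSquare≤y²⇒modulus≤y {z} 0≤y p =
    x²≤y²⇒x≤y 0≤y (≤-trans (≤-reflexive (modulus² z)) p)

  -- `√` is specified only by its sign and its square, so invariance of the modulus under equality,
  -- negation and conjugation is read off from squares.
  normSquare-≈⇒modulus-≤ : ∀ {z w} → normSquare z ≈ normSquare w → modulus z ≤ modulus w
  normSquare-≈⇒modulus-≤ {z} {w} p = normSquare≤y²⇒modulus≤y (0≤modulus w)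
    (≤-reflexive (trans p (sym (modulus² w))))

  modulus-cong-≤ : ∀ {z w} → z ≈ᶜ w → modulus z ≤ modulus w
  modulus-cong-≤ (p , q) = normSquare-≈⇒modulus-≤ (+-cong (*-cong p p) (*-cong q q))

  modulus-neg : ∀ z → modulus (-ᶜ z) ≤ modulus z
  modulus-neg z = normSquare-≈⇒modulus-≤ (+-cong (-x*-x≈x*x (re z)) (-x*-x≈x*x (im z)))

  modulus-conj : ∀ z → modulus (conj z) ≤ modulus z
  modulus-conj z = normSquare-≈⇒modulus-≤ (+-congˡ (-x*-x≈x*x (im z)))

  modulus-0 : ∀ {z} → z ≈ᶜ 0ᶜ → modulus z ≤ 0#
  modulus-0 (p , q) = normSquare≤y²⇒modulus≤y ≤-refl (≤-reflexive
    (trans (+-cong (*-cong p p) (*-cong q q))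
      (trans (+-congʳ (zeroˡ 0#)) (+-identityˡ (0# * 0#)))))

  modulus-1 : modulus 1ᶜ ≤ 1#
  modulus-1 = normSquare≤y²⇒modulus≤y (<⇒≤ 0<1) (≤-reflexive
    (trans (+-congˡ (zeroˡ 0#)) (+-identityʳ (1# * 1#))))

  re≤modulus : ∀ z → re z ≤ modulus z
  re≤modulus z = x²≤y²⇒x≤y (0≤modulus z)
    (≤-trans (0≤y⇒x≤x+y (0≤x² (im z))) (≤-reflexive (sym (modulus² z))))

  -- The two-square identity of Brahmagupta and Fibonacci.
  normSquare-* : ∀ z w → normSquare (z *ᶜ w) ≈ normSquare z * normSquare w
  normSquare-* (a +i b) (c +i d) = begin-equality
    (a * c - b * d) * (a * c - b * d) + (a * d + b * c) * (a * d + b * c)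
      ≈⟨ +-congʳ (*-cong re≈ re≈) ⟩
    (a * c + b * d′) * (a * c + b * d′) + (a * d + b * c) * (a * d + b * c)
      -- The solver works over semirings, so `- d` enters as an independent variable `d′`. The cross
      -- terms collect into a multiple of `d + d′`, which the next step cancels.
      ≈⟨ solve 5 (λ a b c d d′ →
           (a :* c :+ b :* d′) :* (a :* c :+ b :* d′) :+ (a :* d :+ b :* c) :* (a :* d :+ b :* c)
           := (a :* a :* (c :* c :+ d :* d) :+ b :* b :* (c :* c :+ d′ :* d′))
              :+ (a :* b :* c :+ a :* b :* c) :* (d :+ d′)) refl a b c d d′ ⟩
    (a * a * (c * c + d * d) + b * b * (c * c + d′ * d′)) + (a * b * c + a * b * c) * (d + d′)
      ≈⟨ +-cong (+-congˡ (*-congˡ (+-congˡ (-x*-x≈x*x d))))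
                (trans (*-congˡ (-‿inverseʳ d)) (zeroʳ _)) ⟩
    (a * a * (c * c + d * d) + b * b * (c * c + d * d)) + 0#
      ≈⟨ +-identityʳ _ ⟩
    a * a * (c * c + d * d) + b * b * (c * c + d * d)
      ≈⟨ distribʳ _ _ _ ⟨
    (a * a + b * b) * (c * c + d * d) ∎
    where
    d′ : Carrier
    d′ = - d
    re≈ : a * c - b * d ≈ a * c + b * d′
    re≈ = +-congˡ (-‿distribʳ-* b d)

  modulus-* : ∀ z w → modulus (z *ᶜ w) ≤ modulus z * modulus w
  modulus-* z w = normSquare≤y²⇒modulus≤y (*-nonneg (0≤modulus z) (0≤modulus w)) (begin
    normSquare (z *ᶜ w)                                  ≈⟨ normSquare-* z w ⟩
    normSquare z * normSquare w                          ≈⟨ *-cong (modulus² z) (modulus² w) ⟨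
    modulus z * modulus z * (modulus w * modulus w)
      ≈⟨ solve 2 (λ p q → p :* p :* (q :* q) := p :* q :* (p :* q)) refl (modulus z) (modulus w) ⟩
    modulus z * modulus w * (modulus z * modulus w)      ∎)

  -- Cauchy-Schwarz in the plane: the dot product is the real part of `z *ᶜ conj w`, hence at most
  -- the modulus of that product.
  dot≤modulus*modulus : ∀ z w → re z * re w + im z * im w ≤ modulus z * modulus w
  dot≤modulus*modulus z w = begin
    re z * re w + im z * im w       ≈⟨ +-congˡ (-‿involutive (im z * im w)) ⟨
    re z * re w - - (im z * im w)   ≈⟨ +-congˡ (-‿cong (-‿distribʳ-* (im z) (im w))) ⟩
    re (z *ᶜ conj w)                ≤⟨ re≤modulus (z *ᶜ conj w) ⟩
    modulus (z *ᶜ conj w)           ≤⟨ modulus-* z (conj w) ⟩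
    modulus z * modulus (conj w)
      ≤⟨ *-mono-≤ (0≤modulus z) (0≤modulus (conj w)) ≤-refl (modulus-conj w) ⟩
    modulus z * modulus w           ∎

  -- After squaring, the cross term of the left side is twice the dot product, which Cauchy-Schwarz
  -- bounds by the cross term of the right side.
  modulus-triangle : ∀ z w → modulus (z +ᶜ w) ≤ modulus z + modulus w
  modulus-triangle z w = normSquare≤y²⇒modulus≤y
    (0≤x∧0≤y⇒0≤x+y (0≤modulus z) (0≤modulus w)) (begin
    normSquare (z +ᶜ w)
      ≈⟨ solve 4 (λ a b c d →
           (a :+ c) :* (a :+ c) :+ (b :+ d) :* (b :+ d)
           := ((a :* a :+ b :* b) :+ (c :* c :+ d :* d))
              :+ ((a :* c :+ b :* d) :+ (a :* c :+ b :* d))) refl (re z) (im z) (re w) (im w) ⟩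
    (normSquare z + normSquare w) + (dot + dot)
      ≤⟨ +-mono-≤ (≤-reflexive (+-cong (sym (modulus² z)) (sym (modulus² w))))
                  (+-mono-≤ (dot≤modulus*modulus z w) (dot≤modulus*modulus z w)) ⟩
    (modulus z * modulus z + modulus w * modulus w)
      + (modulus z * modulus w + modulus z * modulus w)
      ≈⟨ solve 2 (λ p q → (p :* p :+ q :* q) :+ (p :* q :+ p :* q)
           := (p :+ q) :* (p :+ q)) refl (modulus z) (modulus w) ⟩
    (modulus z + modulus w) * (modulus z + modulus w) ∎)
    where
    dot : Carrier
    dot = re z * re w + im z * im w

  modulus-sub-comm : ∀ z w → modulus (z -ᶜ w) ≤ modulus (w -ᶜ z)
  modulus-sub-comm z w = ≤-trans
    (modulus-cong-≤ (sym (-[x-y]≈y-x (re w) (re z)) , sym (-[x-y]≈y-x (im w) (im z))))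
    (modulus-neg (w -ᶜ z))

  modulus-sub-triangle : ∀ u v w → modulus (u -ᶜ w) ≤ modulus (u -ᶜ v) + modulus (v -ᶜ w)
  modulus-sub-triangle u v w = ≤-trans
    (modulus-cong-≤ (x-z≈[x-y]+[y-z] (re u) (re v) (re w) , x-z≈[x-y]+[y-z] (im u) (im v) (im w)))
    (modulus-triangle (u -ᶜ v) (v -ᶜ w))

  modulus-sum : ∀ {n} (v : Vector ℂ n) → modulus (sumᶜ v) ≤ sum (modulus ∘ v)
  modulus-sum {zero}  v = modulus-0 (refl , refl)
  modulus-sum {suc n} v = ≤-trans (modulus-triangle (v zero) (sumᶜ (v ∘ suc)))
    (+-monoʳ-≤ (modulus (v zero)) (modulus-sum (v ∘ suc)))

  -- A real or imaginary part apart from zero would make `normSquare z` positive; tightness then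
  -- gives equality with zero.
  modulus≤0⇒≈0 : ∀ {z} → modulus z ≤ 0# → re z ≈ 0# × im z ≈ 0#
  modulus≤0⇒≈0 {z} ∣z∣≤0 =
    ¬x#y⇒x≈y (λ re#0 → normSquare≤0 (0<x∧0≤y⇒0<x+y (x#0⇒0<x² re#0) (0≤x² (im z)))) ,
    ¬x#y⇒x≈y (λ im#0 → normSquare≤0
      (<-respʳ-≈ (+-comm _ _) (0<x∧0≤y⇒0<x+y (x#0⇒0<x² im#0) (0≤x² (re z)))))
    where
    normSquare≤0 : normSquare z ≤ 0#
    normSquare≤0 = begin
      normSquare z           ≈⟨ modulus² z ⟨
      modulus z * modulus z  ≤⟨ *-monoˡ-≤ (0≤modulus z) ∣z∣≤0 ⟩
      0# * modulus z         ≈⟨ zeroˡ (modulus z) ⟩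
      0#                     ∎

module Recovery {c ℓ₁ ℓ₂} (R : RealNumbers c ℓ₁ ℓ₂) where
  open RealNumbers R
  open Bandlimiting R
  open OrderedField R
  open Modulus R
  open Solver using (solve; con; _:+_; _:*_; _:=_)
  open ≤-Reasoning

  -- Linearity of matrix action over the complex numbers.

  *ᶜ-zeroˡ : ∀ z → 0ᶜ *ᶜ z ≈ᶜ 0ᶜ
  *ᶜ-zeroˡ z =
    trans (+-cong (zeroˡ (re z)) (trans (-‿cong (zeroˡ (im z))) -0#≈0#)) (+-identityˡ 0#) ,
    trans (+-cong (zeroˡ (im z)) (zeroˡ (re z))) (+-identityˡ 0#)

  *ᶜ-zeroʳ : ∀ z → z *ᶜ 0ᶜ ≈ᶜ 0ᶜ
  *ᶜ-zeroʳ z =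
    trans (+-cong (zeroʳ (re z)) (trans (-‿cong (zeroʳ (im z))) -0#≈0#)) (+-identityˡ 0#) ,
    trans (+-cong (zeroʳ (re z)) (zeroʳ (im z))) (+-identityˡ 0#)

  *ᶜ-distribˡ--ᶜ : ∀ z u w → z *ᶜ (u -ᶜ w) ≈ᶜ z *ᶜ u -ᶜ z *ᶜ w
  *ᶜ-distribˡ--ᶜ (a +i b) (p +i q) (r +i t) =
    trans (+-cong (x[y-z]≈xy-xz a p r) (trans (-‿cong (x[y-z]≈xy-xz b q t)) (sym (-‿+-comm _ _))))
      (trans (+-interchange (a * p) (- (a * r)) (- (b * q)) (- - (b * t)))
        (+-congˡ (-‿+-comm _ _))) ,
    trans (+-cong (x[y-z]≈xy-xz a q t) (x[y-z]≈xy-xz b p r))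
      (sym ([w+x]-[y+z]≈[w-y]+[x-z] (a * q) (b * p) (a * t) (b * r)))

  sumᶜ-cong : ∀ {n} {v w : Vector ℂ n} → v ≈ᵥ w → sumᶜ v ≈ᶜ sumᶜ w
  sumᶜ-cong {zero}  v≈w = refl , refl
  sumᶜ-cong {suc n} v≈w with v≈w zero | sumᶜ-cong (v≈w ∘ suc)
  ... | p , q | p′ , q′ = +-cong p p′ , +-cong q q′

  sumᶜ-sub : ∀ {n} (v w : Vector ℂ n) → sumᶜ (v -ᵥ w) ≈ᶜ sumᶜ v -ᶜ sumᶜ w
  sumᶜ-sub {zero}  v w = sym (-‿inverseʳ 0#) , sym (-‿inverseʳ 0#)
  sumᶜ-sub {suc n} v w with sumᶜ-sub (v ∘ suc) (w ∘ suc)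
  ... | p , q =
    trans (+-congˡ p) (sym ([w+x]-[y+z]≈[w-y]+[x-z] (re (v zero)) _ (re (w zero)) _)) ,
    trans (+-congˡ q) (sym ([w+x]-[y+z]≈[w-y]+[x-z] (im (v zero)) _ (im (w zero)) _))

  *ᵥ-distribˡ--ᵥ : ∀ {N} (A : Matrix N) x y → A *ᵥ (x -ᵥ y) ≈ᵥ A *ᵥ x -ᵥ A *ᵥ y
  *ᵥ-distribˡ--ᵥ A x y i = trans (proj₁ p) (proj₁ q) , trans (proj₂ p) (proj₂ q)
    where
    p = sumᶜ-cong λ j → *ᶜ-distribˡ--ᶜ (A i j) (x j) (y j)
    q = sumᶜ-sub (λ j → A i j *ᶜ x j) (λ j → A i j *ᶜ y j)

  -- Puts the error of a bandlimited competitor back into the bandlimited space, so that the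
  -- entrywise bound applies to it.
  bandlimited-sub : ∀ {N} (U : Matrix N) F {x y} →
    Bandlimited U F x → Bandlimited U F y → Bandlimited U F (x -ᵥ y)
  bandlimited-sub U F {x} {y} Bx≈x By≈y i =
    trans (proj₁ p) (+-cong (proj₁ (Bx≈x i)) (-‿cong (proj₁ (By≈y i)))) ,
    trans (proj₂ p) (+-cong (proj₂ (Bx≈x i)) (-‿cong (proj₂ (By≈y i))))
    where p = *ᵥ-distribˡ--ᵥ (bandlimiter U F) x y i

  0≤∥_∥₁ : ∀ {N} (x : Vector ℂ N) → 0# ≤ ∥ x ∥₁
  0≤∥ x ∥₁ = sum-nonneg (0≤modulus ∘ x)

  -- Entries of the 0/1 diagonal projections.

  projection-offDiagonal : ∀ {N} (S : Subset N) {i j} → i ≢ j → projection S i j ≡ 0ᶜ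
  projection-offDiagonal S {i} {j} i≢j with i ≟ j
  ... | yes i≡j = ⊥-elim (i≢j i≡j)
  ... | no  _   = ≡.refl

  projection-diagonal : ∀ {N} (S : Subset N) i →
    projection S i i ≡ (if lookup S i then 1ᶜ else 0ᶜ)
  projection-diagonal S i with i ≟ i
  ... | yes _   = ≡.refl
  ... | no  i≢i = ⊥-elim (i≢i ≡.refl)

  projection-zero-row : ∀ {N} (S : Subset N) {i} → lookup S i ≡ false →
    ∀ j → projection S i j ≡ 0ᶜ
  projection-zero-row S {i} i∉S j with i ≟ j
  ... | yes _ rewrite i∉S = ≡.refl
  ... | no  _ = ≡.refl

  projection-zero-column : ∀ {N} (S : Subset N) {j} → lookup S j ≡ false →
    ∀ i → projection S i j ≡ 0ᶜ
  projection-zero-column S {j} j∉S i with i ≟ j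
  ... | yes ≡.refl rewrite j∉S = ≡.refl
  ... | no  _ = ≡.refl

  modulus-projection*ᵥ : ∀ {N} (S : Subset N) (n : Vector ℂ N) {i} → lookup S i ≡ false →
    modulus ((projection S *ᵥ n) i) ≤ 0#
  modulus-projection*ᵥ S n {i} i∉S =
    ≤-trans (modulus-sum λ j → projection S i j *ᶜ n j) (sum-nonpos λ j →
      modulus-0 (≡.subst (λ z → z *ᶜ n j ≈ᶜ 0ᶜ) (≡.sym (projection-zero-row S i∉S j))
        (*ᶜ-zeroˡ (n j))))

  -- Bounds on the entries of the bandlimiter and of bandlimited vectors.

  modulus≤μ : ∀ {N} (U : Matrix N) (F : Subset N) {j} → lookup F j ≡ true →
    ∀ i → modulus (U i j) ≤ μ U F
  modulus≤μ {N} U F {j} j∈F i = ≤-trans (maximum-upperBound (λ i → modulus (U i j)) i)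
    (≡.subst (λ b → (if b then maximum (λ i → modulus (U i j)) else 0#) ≤ μ U F) j∈F
      (maximum-upperBound {N} (λ j → if lookup F j then maximum (λ i → modulus (U i j)) else 0#) j))

  -- Right multiplication by the projection keeps the columns of `U` indexed by `F` and erases the
  -- others.
  modulus-*projection : ∀ {N} (U : Matrix N) (F : Subset N) i k →
    modulus ((U *ₘ projection F) i k) ≤ (if lookup F k then modulus (U i k) else 0#)
  modulus-*projection U F i k = ≤-trans (modulus-sum λ l → U i l *ᶜ projection F l k) bound
    where
    entry≤0 : ∀ l → projection F l k ≡ 0ᶜ → modulus (U i l *ᶜ projection F l k) ≤ 0#
    entry≤0 l eq = modulus-0 (≡.subst (λ z → U i l *ᶜ z ≈ᶜ 0ᶜ) (≡.sym eq) (*ᶜ-zeroʳ (U i l)))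

    bound : sum (λ l → modulus (U i l *ᶜ projection F l k))
            ≤ (if lookup F k then modulus (U i k) else 0#)
    bound with lookup F k in eq
    ... | false = sum-nonpos λ l → entry≤0 l (projection-zero-column F eq l)
    ... | true  = begin
      sum (λ l → modulus (U i l *ᶜ projection F l k))
        ≤⟨ sum≤entry k (λ l l≢k → entry≤0 l (projection-offDiagonal F l≢k)) ⟩
      modulus (U i k *ᶜ projection F k k)
        ≡⟨ ≡.cong (λ z → modulus (U i k *ᶜ z))
             (≡.trans (projection-diagonal F k) (≡.cong (if_then 1ᶜ else 0ᶜ) eq)) ⟩
      modulus (U i k *ᶜ 1ᶜ)
        ≤⟨ modulus-* (U i k) 1ᶜ ⟩
      modulus (U i k) * modulus 1ᶜ
        ≤⟨ *-mono-≤ (0≤modulus (U i k)) (0≤modulus 1ᶜ) ≤-refl modulus-1 ⟩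
      modulus (U i k) * 1#
        ≈⟨ *-identityʳ (modulus (U i k)) ⟩
      modulus (U i k) ∎

  -- The entry is the sum over `k` in `F` of `U i k` times the conjugate of `U j k`: one term for
  -- each element of `F`, each of modulus at most the square of `μ U F`.
  modulus-bandlimiter : ∀ {N} (U : Matrix N) (F : Subset N) i j →
    modulus (bandlimiter U F i j) ≤ fromℕ ∣ F ∣ * (μ U F * μ U F)
  modulus-bandlimiter U F i j = begin
    modulus (bandlimiter U F i j)
      ≤⟨ modulus-sum (λ k → (U *ₘ projection F) i k *ᶜ (U †) k j) ⟩
    sum (λ k → modulus ((U *ₘ projection F) i k *ᶜ (U †) k j))
      ≤⟨ sum-mono-≤ term ⟩
    sum (λ k → if lookup F k then μ U F * μ U F else 0#)
      ≈⟨ sum-indicator F (μ U F * μ U F) ⟩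
    fromℕ ∣ F ∣ * (μ U F * μ U F) ∎
    where
    term : ∀ k → modulus ((U *ₘ projection F) i k *ᶜ (U †) k j)
                 ≤ (if lookup F k then μ U F * μ U F else 0#)
    term k with lookup F k in eq | modulus-*projection U F i k
    ... | false | p = begin
      modulus ((U *ₘ projection F) i k *ᶜ (U †) k j)
        ≤⟨ modulus-* ((U *ₘ projection F) i k) ((U †) k j) ⟩
      modulus ((U *ₘ projection F) i k) * modulus ((U †) k j)
        ≤⟨ *-monoˡ-≤ (0≤modulus ((U †) k j)) p ⟩
      0# * modulus ((U †) k j)
        ≈⟨ zeroˡ _ ⟩
      0# ∎
    ... | true | p = begin
      modulus ((U *ₘ projection F) i k *ᶜ (U †) k j)
        ≤⟨ modulus-* ((U *ₘ projection F) i k) ((U †) k j) ⟩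
      modulus ((U *ₘ projection F) i k) * modulus ((U †) k j)
        -- Nonnegativity of `μ U F` comes from the entry `U i k`, whose modulus lies below it
        -- because `k` is in `F`.
        ≤⟨ *-mono-≤ (≤-trans (0≤modulus (U i k)) (modulus≤μ U F eq i)) (0≤modulus ((U †) k j))
             (≤-trans p (modulus≤μ U F eq i))
             (≤-trans (modulus-conj (U j k)) (modulus≤μ U F eq j)) ⟩
      μ U F * μ U F ∎

  -- Since `x` is its own image under the bandlimiter, a uniform bound on the matrix entries turns
  -- its 1-norm into a bound on each coordinate.
  bandlimited-entry≤ : ∀ {N} (U : Matrix N) (F : Subset N) x → Bandlimited U F x →
    ∀ i → modulus (x i) ≤ fromℕ ∣ F ∣ * (μ U F * μ U F) * ∥ x ∥₁
  bandlimited-entry≤ U F x Bx≈x i = begin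
    modulus (x i)
      ≤⟨ modulus-cong-≤ (sym (proj₁ (Bx≈x i)) , sym (proj₂ (Bx≈x i))) ⟩
    modulus (sumᶜ λ j → bandlimiter U F i j *ᶜ x j)
      ≤⟨ modulus-sum (λ j → bandlimiter U F i j *ᶜ x j) ⟩
    sum (λ j → modulus (bandlimiter U F i j *ᶜ x j))
      ≤⟨ sum-mono-≤ (λ j → ≤-trans (modulus-* (bandlimiter U F i j) (x j))
           (*-monoˡ-≤ (0≤modulus (x j)) (modulus-bandlimiter U F i j))) ⟩
    sum (λ j → fromℕ ∣ F ∣ * (μ U F * μ U F) * modulus (x j))
      ≈⟨ *-distribˡ-sum (fromℕ ∣ F ∣ * (μ U F * μ U F)) (modulus ∘ x) ⟨
    fromℕ ∣ F ∣ * (μ U F * μ U F) * ∥ x ∥₁ ∎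

  -- Vertexwise comparison of the residuals of `s` and of a competitor.

  residual+error≤ : ∀ {N} (S : Subset N) (r s s′ : Vector ℂ N) b →
    (∀ i → lookup S i ≡ false → modulus ((r -ᵥ s) i) ≤ 0#) →
    (∀ i → modulus ((s′ -ᵥ s) i) ≤ b) →
    ∥ r -ᵥ s ∥₁ + ∥ s′ -ᵥ s ∥₁ ≤ ∥ r -ᵥ s′ ∥₁ + fromℕ ∣ S ∣ * (b + b)
  residual+error≤ S r s s′ b off-S error≤b = begin
    ∥ r -ᵥ s ∥₁ + ∥ s′ -ᵥ s ∥₁
      ≈⟨ ∑-distrib-+ (modulus ∘ (r -ᵥ s)) (modulus ∘ (s′ -ᵥ s)) ⟨
    sum (λ i → modulus ((r -ᵥ s) i) + modulus ((s′ -ᵥ s) i))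
      ≤⟨ sum-mono-≤ term ⟩
    sum (λ i → modulus ((r -ᵥ s′) i) + (if lookup S i then b + b else 0#))
      ≈⟨ ∑-distrib-+ (modulus ∘ (r -ᵥ s′)) (λ i → if lookup S i then b + b else 0#) ⟩
    ∥ r -ᵥ s′ ∥₁ + sum (λ i → if lookup S i then b + b else 0#)
      ≈⟨ +-congˡ (sum-indicator S (b + b)) ⟩
    ∥ r -ᵥ s′ ∥₁ + fromℕ ∣ S ∣ * (b + b) ∎
    where
    term : ∀ i → modulus ((r -ᵥ s) i) + modulus ((s′ -ᵥ s) i)
                 ≤ modulus ((r -ᵥ s′) i) + (if lookup S i then b + b else 0#)
    term i with lookup S i in eq
    -- On `S` the residual of `s` is compared through `s′`, which costs a second copy of the error;
    -- hence `b + b`.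
    ... | true = begin
      modulus ((r -ᵥ s) i) + modulus ((s′ -ᵥ s) i)
        ≤⟨ +-monoˡ-≤ _ (modulus-sub-triangle (r i) (s′ i) (s i)) ⟩
      modulus ((r -ᵥ s′) i) + modulus ((s′ -ᵥ s) i) + modulus ((s′ -ᵥ s) i)
        ≈⟨ +-assoc _ _ _ ⟩
      modulus ((r -ᵥ s′) i) + (modulus ((s′ -ᵥ s) i) + modulus ((s′ -ᵥ s) i))
        ≤⟨ +-monoʳ-≤ _ (+-mono-≤ (error≤b i) (error≤b i)) ⟩
      modulus ((r -ᵥ s′) i) + (b + b) ∎
    -- Off `S` the roles change: the error is compared through `r`, and the residual of `s` is zero,
    -- so nothing is lost.
    ... | false = begin
      modulus ((r -ᵥ s) i) + modulus ((s′ -ᵥ s) i)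
        ≤⟨ +-mono-≤ (off-S i eq) (modulus-sub-triangle (s′ i) (r i) (s i)) ⟩
      0# + (modulus ((s′ -ᵥ r) i) + modulus ((r -ᵥ s) i))
        ≈⟨ +-identityˡ _ ⟩
      modulus ((s′ -ᵥ r) i) + modulus ((r -ᵥ s) i)
        ≤⟨ +-mono-≤ (modulus-sub-comm (s′ i) (r i)) (off-S i eq) ⟩
      modulus ((r -ᵥ s′) i) + 0# ∎

  -- Minimality and uniqueness for a fixed signal and noise, with the size condition multiplied out.

  module _ {N} (U : Matrix N) (F S : Subset N) (s n : Vector ℂ N) (s∈B : Bandlimited U F s)
           (κ<1 : fromℕ ∣ S ∣ * 2μ²∣F∣ U F < 1#) where

    κ : Carrier
    κ = fromℕ ∣ S ∣ * 2μ²∣F∣ U F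

    r : Vector ℂ N
    r = s +ᵥ (projection S *ᵥ n)

    residual-off-S : ∀ i → lookup S i ≡ false → modulus ((r -ᵥ s) i) ≤ 0#
    residual-off-S i i∉S = ≤-trans
      (modulus-cong-≤ (x+y-x≈y (re (s i)) _ , x+y-x≈y (im (s i)) _))
      (modulus-projection*ᵥ S n i∉S)

    residual+error≤κ : ∀ s′ → Bandlimited U F s′ →
      ∥ r -ᵥ s ∥₁ + ∥ s′ -ᵥ s ∥₁ ≤ ∥ r -ᵥ s′ ∥₁ + κ * ∥ s′ -ᵥ s ∥₁
    residual+error≤κ s′ s′∈B = begin
      ∥ r -ᵥ s ∥₁ + ∥ s′ -ᵥ s ∥₁
        ≤⟨ residual+error≤ S r s s′ b residual-off-S
             (bandlimited-entry≤ U F (s′ -ᵥ s) (bandlimited-sub U F s′∈B s∈B)) ⟩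
      ∥ r -ᵥ s′ ∥₁ + fromℕ ∣ S ∣ * (b + b)
        -- The constant is `fromℕ 2` unfolded: the two copies of the error bound supply the factor 2
        -- in `2μ²∣F∣`.
        ≈⟨ +-congˡ (solve 4 (λ σ φ m x →
             σ :* (φ :* m :* x :+ φ :* m :* x) := σ :* ((con 1 :+ (con 1 :+ con 0)) :* m :* φ) :* x)
             refl (fromℕ ∣ S ∣) (fromℕ ∣ F ∣) (μ U F * μ U F) ∥ s′ -ᵥ s ∥₁) ⟩
      ∥ r -ᵥ s′ ∥₁ + κ * ∥ s′ -ᵥ s ∥₁ ∎
      where
      b : Carrier
      b = fromℕ ∣ F ∣ * (μ U F * μ U F) * ∥ s′ -ᵥ s ∥₁

    -- Raising `κ` to 1 is allowed because the error norm is nonnegative; the error norm then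
    -- cancels from both sides.
    minimal : ∀ s′ → Bandlimited U F s′ → ∥ r -ᵥ s ∥₁ ≤ ∥ r -ᵥ s′ ∥₁
    minimal s′ s′∈B = +-cancelʳ-≤ ∥ s′ -ᵥ s ∥₁ (begin
      ∥ r -ᵥ s ∥₁ + ∥ s′ -ᵥ s ∥₁
        ≤⟨ residual+error≤κ s′ s′∈B ⟩
      ∥ r -ᵥ s′ ∥₁ + κ * ∥ s′ -ᵥ s ∥₁
        ≤⟨ +-monoʳ-≤ _ (*-monoˡ-≤ 0≤∥ s′ -ᵥ s ∥₁ (<⇒≤ κ<1)) ⟩
      ∥ r -ᵥ s′ ∥₁ + 1# * ∥ s′ -ᵥ s ∥₁
        ≈⟨ +-congˡ (*-identityˡ _) ⟩
      ∥ r -ᵥ s′ ∥₁ + ∥ s′ -ᵥ s ∥₁ ∎)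

    -- A positive error norm would make `κ` times it strictly smaller than itself, and a competitor
    -- no worse than `s` would then violate `residual+error≤κ`.
    error≤0 : ∀ s′ → Bandlimited U F s′ → ∥ r -ᵥ s′ ∥₁ ≤ ∥ r -ᵥ s ∥₁ → ∥ s′ -ᵥ s ∥₁ ≤ 0#
    error≤0 s′ s′∈B s′-minimal 0<error = residual+error≤κ s′ s′∈B (begin-strict
      ∥ r -ᵥ s′ ∥₁ + κ * ∥ s′ -ᵥ s ∥₁
        <⟨ +-monoʳ-< _ (*-monoˡ-< 0<error κ<1) ⟩
      ∥ r -ᵥ s′ ∥₁ + 1# * ∥ s′ -ᵥ s ∥₁
        ≈⟨ +-congˡ (*-identityˡ _) ⟩
      ∥ r -ᵥ s′ ∥₁ + ∥ s′ -ᵥ s ∥₁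
        ≤⟨ +-monoˡ-≤ _ s′-minimal ⟩
      ∥ r -ᵥ s ∥₁ + ∥ s′ -ᵥ s ∥₁ ∎)

    minimizer-unique : ∀ s′ → Bandlimited U F s′ → ∥ r -ᵥ s′ ∥₁ ≤ ∥ r -ᵥ s ∥₁ → s′ ≈ᵥ s
    minimizer-unique s′ s′∈B s′-minimal i =
      x-y≈0⇒x≈y _ _ (proj₁ error≈0) , x-y≈0⇒x≈y _ _ (proj₂ error≈0)
      where
      -- Each coordinate of the error is dominated by its 1-norm, so definiteness of the modulus
      -- applies coordinatewise.
      error≈0 = modulus≤0⇒≈0 (≤-trans (entry≤sum (0≤modulus ∘ (s′ -ᵥ s)) i)
        (error≤0 s′ s′∈B s′-minimal))

  -- Clearing the reciprocal from the size hypothesis.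

  recip-inverse : ∀ {x} (0<x : 0# < x) → recip x 0<x * x ≈ 1#
  -- Apartness of `x` from `0#` yields an inverse of the difference `x - 0#`, which is rewritten to
  -- `x`.
  recip-inverse {x} 0<x = trans (*-congˡ (sym (x-0≈x x)))
    (proj₁ (proj₂ (IsHeytingField.#⇒invertible isHeytingField {x} {0#} (inj₂ 0<x))))
    where open HeytingProperties heytingCommutativeRing using (x-0≈x)

  y<recip⇒yx<1 : ∀ {x y} (0<x : 0# < x) → y < recip x 0<x → y * x < 1#
  y<recip⇒yx<1 0<x y<x⁻¹ = <-respʳ-≈ (recip-inverse 0<x) (*-monoˡ-< 0<x y<x⁻¹)

theoremV5 : ∀ {c ℓ₁ ℓ₂} (R : RealNumbers c ℓ₁ ℓ₂) →
    let open RealNumbers R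
        open Bandlimiting R in
    ∀ (N : ℕ) (U : Matrix N) (unitary : IsUnitary U)
      (F : Subset N) (F≠∅ : Nonempty F) (S : Subset N) →
    fromℕ ∣ S ∣ < recip (2μ²∣F∣ U F) (0<2μ²∣F∣ U F unitary F≠∅) →
    ∀ (s n : Vector ℂ N) → Bandlimited U F s →
    let r = s +ᵥ (projection S *ᵥ n) in
    IsReconstruction U F r s ×
    (∀ s̃ → IsReconstruction U F r s̃ → s̃ ≈ᵥ s)
theoremV5 R N U unitary F F≠∅ S ∣S∣<1/2μ²∣F∣ s n s∈B =
  (s∈B , minimal U F S s n s∈B κ<1) ,
  λ s̃ s̃-recon → minimizer-unique U F S s n s∈B κ<1 s̃ (proj₁ s̃-recon) (proj₂ s̃-recon s s∈B)
  where
  open Bandlimiting R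
  open Recovery R
  -- Multiplying the size hypothesis by the positive number `2μ²∣F∣ U F` gives the contraction
  -- factor below 1.
  κ<1 = y<recip⇒yx<1 (0<2μ²∣F∣ U F unitary F≠∅) ∣S∣<1/2μ²∣F∣
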